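{- Let $n\geq 3$ be an integer and let $C_n$ be the cycle of order $n$. If $n\equiv 1 \pmod 3$ or $n\equiv 2\pmod 3$, then $C_n$ is an SR-graph. Otherwise (i.e. if $n\equiv 0\pmod 3$), $C_n$ is an ASR-graph.
   Context: $\gamma(G)$ denotes the domination number of a finite simple graph $G$. For an edge $e=uv$ of $G$, $G-e$ is the graph obtained by deleting $e$, and $G_e$ is the graph obtained by subdividing $e$: delete $e$, add a new vertex $w$ and the edges $uw$ and $wv$. A finite connected simple graph $G$ of order at least two is an SR-graph (sub-removable graph) if $\gamma(G-e)=\gamma(G_e)$ for every edge $e$ of $G$, and an ASR-graph (anti-sub-removable graph) if $\gamma(G-e)\neq\gamma(G_e)$ for every edge $e$ of $G$. -}

module Defs where

open import Data.Empty using (⊥; ⊥-elim)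
open import Data.Fin.Base using (Fin; zero; suc; toℕ)
open import Data.Fin.Properties using (all?; any?) renaming (_≟_ to _≟F_)
open import Data.Fin.Subset using (Subset; inside; outside; _∈_; _∉_; ∣_∣; ⊤)
open import Data.Fin.Subset.Properties using (_∈?_; ∈⊤)
open import Data.List.Base using (List; []; _∷_; filter; map; _++_)
open import Data.List.Extrema.Nat using (argmin; argmin-all; f[argmin]≤f[xs])
open import Data.List.Membership.Propositional using () renaming (_∈_ to _∈ˡ_)
open import Data.List.Membership.Propositional.Properties
  using (∈-++⁺ˡ; ∈-++⁺ʳ; ∈-map⁺; ∈-filter⁺)
open import Data.List.Relation.Unary.All using () renaming (lookup to All-lookup)
open import Data.List.Relation.Unary.All.Properties using (all-filter)
open import Data.List.Relation.Unary.Any using (here)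
open import Data.Nat.Base using (ℕ; zero; suc; _≤_; s≤s)
open import Data.Nat.Properties using (1+n≢n) renaming (_≟_ to _≟ℕ_)
open import Data.Product.Base using (_×_; _,_; ∃-syntax)
open import Data.Sum.Base using (_⊎_; inj₁; inj₂; swap)
open import Data.Vec.Base using ([]; _∷_)
open import Level using (0ℓ)
open import Relation.Binary.Core using (Rel)
open import Relation.Binary.Definitions using (Decidable; Irreflexive; Symmetric)
open import Relation.Binary.Construct.Closure.ReflexiveTransitive using (Star)
open import Relation.Binary.PropositionalEquality using (_≡_; _≢_; refl) renaming (sym to ≡-sym)
open import Relation.Nullary.Decidable
  using (Dec; no; _×-dec_; _⊎-dec_; _→-dec_; ¬?)
open import Relation.Nullary.Negation using (¬_)

record Graph (n : ℕ) : Set₁ where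
  field
    Adj    : Rel (Fin n) 0ℓ
    sym    : Symmetric Adj
    irrefl : Irreflexive _≡_ Adj
    adj?   : Decidable Adj

open Graph public using (Adj; adj?)

-- Each undirected edge is represented twice, once per orientation.
record Edge {n : ℕ} (G : Graph n) : Set where
  constructor edge
  field
    end₁ end₂ : Fin n
    adjacent  : Adj G end₁ end₂

open Edge public

Connected : ∀ {n} → Graph n → Set
Connected G = ∀ u v → Star (Adj G) u v

Dominating : ∀ {n} → Graph n → Subset n → Set
Dominating G D = ∀ v → v ∉ D → ∃[ u ] (u ∈ D × Adj G u v)

dominating? : ∀ {n} (G : Graph n) (D : Subset n) → Dec (Dominating G D)
dominating? G D =
  all? λ v → ¬? (v ∈? D) →-dec any? λ u → (u ∈? D) ×-dec adj? G u v

subsets : ∀ n → List (Subset n)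
subsets zero    = [] ∷ []
subsets (suc n) = map (inside ∷_) (subsets n) ++ map (outside ∷_) (subsets n)

-- The default value ⊤ is itself dominating; γ-attained and γ-minimal below
-- characterise γ.
γ-set : ∀ {n} → Graph n → Subset n
γ-set {n} G = argmin ∣_∣ ⊤ (filter (dominating? G) (subsets n))

γ : ∀ {n} → Graph n → ℕ
γ G = ∣ γ-set G ∣

∈-subsets : ∀ {n} (D : Subset n) → D ∈ˡ subsets n
∈-subsets []            = here refl
∈-subsets (inside ∷ D)  = ∈-++⁺ˡ (∈-map⁺ (inside ∷_) (∈-subsets D))
∈-subsets (outside ∷ D) =
  ∈-++⁺ʳ (map (inside ∷_) (subsets _)) (∈-map⁺ (outside ∷_) (∈-subsets D))

γ-attained : ∀ {n} (G : Graph n) → ∃[ D ] (Dominating G D × ∣ D ∣ ≡ γ G)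
γ-attained {n} G = γ-set G , dom , refl
  where
  dom : Dominating G (γ-set G)
  dom = argmin-all ∣_∣ (λ v v∉⊤ → ⊥-elim (v∉⊤ ∈⊤))
          (all-filter (dominating? G) (subsets n))

γ-minimal : ∀ {n} (G : Graph n) (D : Subset n) → Dominating G D → γ G ≤ ∣ D ∣
γ-minimal {n} G D dom =
  All-lookup (f[argmin]≤f[xs] ⊤ (filter (dominating? G) (subsets n)))
    (∈-filter⁺ (dominating? G) (∈-subsets D) dom)

infixl 6 _-ₑ_

_-ₑ_ : ∀ {n} (G : Graph n) → Edge G → Graph n
_-ₑ_ {n} G (edge u v _) = record
  { Adj    = λ x y → Adj G x y × ¬ IsE x y
  ; sym    = λ (a , ¬e) → Graph.sym G a , λ e → ¬e (IsE-sym e)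
  ; irrefl = λ x≡y (a , _) → Graph.irrefl G x≡y a
  ; adj?   = λ x y → adj? G x y ×-dec ¬? (isE? x y)
  }
  where
  IsE : Rel (Fin n) 0ℓ
  IsE x y = (x ≡ u × y ≡ v) ⊎ (x ≡ v × y ≡ u)

  IsE-sym : Symmetric IsE
  IsE-sym (inj₁ (p , q)) = inj₂ (q , p)
  IsE-sym (inj₂ (p , q)) = inj₁ (q , p)

  isE? : Decidable IsE
  isE? x y = ((x ≟F u) ×-dec (y ≟F v)) ⊎-dec ((x ≟F v) ×-dec (y ≟F u))

-- The new vertex is zero; an old vertex x becomes suc x.
subdivide : ∀ {n} (G : Graph n) → Edge G → Graph (suc n)
subdivide {n} G e = record
  { Adj    = Adj′
  ; sym    = λ {x} {y} → sym′ x y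
  ; irrefl = λ {x} {y} → irrefl′ x y
  ; adj?   = adj′?
  }
  where
  IsEnd : Fin n → Set
  IsEnd x = x ≡ end₁ e ⊎ x ≡ end₂ e

  isEnd? : ∀ x → Dec (IsEnd x)
  isEnd? x = (x ≟F end₁ e) ⊎-dec (x ≟F end₂ e)

  Adj′ : Rel (Fin (suc n)) 0ℓ
  Adj′ zero    zero    = ⊥
  Adj′ zero    (suc y) = IsEnd y
  Adj′ (suc x) zero    = IsEnd x
  Adj′ (suc x) (suc y) = Adj (G -ₑ e) x y

  sym′ : ∀ x y → Adj′ x y → Adj′ y x
  sym′ zero    (suc y) a = a
  sym′ (suc x) zero    a = a
  sym′ (suc x) (suc y) a = Graph.sym (G -ₑ e) a

  irrefl′ : ∀ x y → x ≡ y → ¬ Adj′ x y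
  irrefl′ (suc x) _ refl a = Graph.irrefl (G -ₑ e) refl a

  adj′? : Decidable Adj′
  adj′? zero    zero    = no λ ()
  adj′? zero    (suc y) = isEnd? y
  adj′? (suc x) zero    = isEnd? x
  adj′? (suc x) (suc y) = adj? (G -ₑ e) x y

record IsSR {n : ℕ} (G : Graph n) : Set where
  field
    order≥2   : 2 ≤ n
    connected : Connected G
    γ-equal   : ∀ (e : Edge G) → γ (G -ₑ e) ≡ γ (subdivide G e)

record IsASR {n : ℕ} (G : Graph n) : Set where
  field
    order≥2    : 2 ≤ n
    connected  : Connected G
    γ-distinct : ∀ (e : Edge G) → γ (G -ₑ e) ≢ γ (subdivide G e)

cycle : ∀ n → 3 ≤ n → Graph n
cycle n 3≤n = record
  { Adj    = λ x y → Next x y ⊎ Next y x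
  ; sym    = swap
  ; irrefl = λ { refl (inj₁ a) → next-irrefl 3≤n a
               ; refl (inj₂ a) → next-irrefl 3≤n a }
  ; adj?   = λ x y → next? x y ⊎-dec next? y x
  }
  where
  Next : Rel (Fin n) 0ℓ
  Next x y = toℕ y ≡ suc (toℕ x) ⊎ (suc (toℕ x) ≡ n × toℕ y ≡ 0)

  next-irrefl : ∀ {x} → 3 ≤ n → ¬ Next x x
  next-irrefl _ (inj₁ p) = 1+n≢n (≡-sym p)
  next-irrefl {zero} (s≤s ()) (inj₂ (refl , _))

  next? : Decidable Next
  next? x y = (toℕ y ≟ℕ suc (toℕ x))
    ⊎-dec ((suc (toℕ x) ≟ℕ n) ×-dec (toℕ y ≟ℕ 0))

{-# OPTIONS --safe #-}

-- Both Cₙ − e and (Cₙ)ₑ have maximum degree at most 2 and a Hamiltonian path.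
-- A vertex of a graph of maximum degree 2 dominates at most three vertices, and
-- every third vertex of a Hamiltonian path dominates the graph, so such a graph
-- of order N has domination number ⌈N/3⌉. Hence γ(Cₙ − e) = ⌈n/3⌉ and
-- γ((Cₙ)ₑ) = ⌈(n+1)/3⌉, which differ exactly when 3 divides n.

module Submission where

open import Defs
open import Data.Fin.Base using (Fin; zero; suc; toℕ; fromℕ; inject₁)
open import Data.Fin.Properties using (toℕ-injective; toℕ-inject₁; toℕ-fromℕ; toℕ<n; injective⇒≤)
open import Data.Fin.Relation.Unary.Top using (view; ‵fromℕ; ‵inject₁)
open import Data.Fin.Subset using (Subset; inside; outside; _∈_; _∪_; ⁅_⁆; ⋃; ∣_∣)
open import Data.Fin.Subset.Properties using (_∈?_; x∈⁅x⁆; x∈p∪q⁺; ∣⊥∣≡0; ∣⁅x⁆∣≡1)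
open import Data.List.Base
  using (List; []; _∷_; _++_; [_]; map; length; tabulate; allFin; concatMap)
open import Data.List.Membership.Propositional using (lose) renaming (_∈_ to _∈ˡ_)
open import Data.List.Membership.Propositional.Properties
  using (∈-∃++; ∈-map⁺; ∈-concatMap⁺; ∈-allFin)
import Data.List.Membership.Setoid.Properties as Membershipₛ
open import Data.List.Properties using (length-map; length-++; length-tabulate; ++-assoc)
open import Data.List.Relation.Binary.Permutation.Propositional using (_↭_; ↭-refl; ↭-sym; ↭⇒↭ₛ)
open import Data.List.Relation.Binary.Permutation.Propositional.Properties
  using (∈-resp-↭; ↭-length; ++-comm)
import Data.List.Relation.Binary.Permutation.Setoid.Properties as ↭ₛ
open import Data.List.Relation.Unary.All using (All; _∷_)
open import Data.List.Relation.Unary.AllPairs using (_∷_)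
open import Data.List.Relation.Unary.Any using (here; there)
open import Data.List.Relation.Unary.Linked as Linked using (Linked; []; [-]; _∷_)
import Data.List.Relation.Unary.Linked.Properties as Linked
open import Data.List.Relation.Unary.Unique.Propositional using (Unique)
open import Data.List.Relation.Unary.Unique.Propositional.Properties using (allFin⁺)
open import Data.Nat using (ℕ; zero; suc; _+_; _*_; _≤_; _%_; _/_; z≤n; s≤s)
open import Data.Nat.Divisibility using (divides-refl)
open import Data.Nat.DivMod
  using (m≡m%n+[m/n]*n; m*n/n≡m; m<n*o⇒m/o<n; +-distrib-/-∣ˡ; +-distrib-/-∣ʳ)
open import Data.Nat.Properties
  using ( ≤-refl; ≤-trans; ≤-reflexive; ≤-antisym; ≤-pred; <⇒≢; n≤1+n; m≤n⇒m≤1+n; 1+n≢n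
        ; suc-injective; +-assoc; +-suc; +-mono-≤; +-monoʳ-≤; module ≤-Reasoning)
open import Data.Product using (∃-syntax; _×_; _,_; proj₁; proj₂)
open import Data.Sum using (_⊎_; inj₁; inj₂)
open import Data.Vec.Base using ([]; _∷_; here; there)
open import Function.Base using (_∘_)
open import Level using (Level; 0ℓ)
open import Relation.Binary.Construct.Closure.ReflexiveTransitive
  using (Star; ε; _◅_; _◅◅_; reverse)
open import Relation.Binary.Core using (Rel)
open import Relation.Binary.PropositionalEquality
  using (_≡_; _≢_; refl; sym; trans; cong; subst; setoid; module ≡-Reasoning)
open import Relation.Nullary.Decidable using (yes; no)
open import Relation.Nullary.Negation using (¬_; contradiction)

private
  variable
    a ℓ : Level
    A : Set a
    n : ℕ

-- Counting with lists and finite subsets.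

-- Sending each vertex to a position where it occurs is an injection of `Fin n` into
-- `Fin (length xs)`.
covering⇒≤length : (xs : List (Fin n)) → (∀ v → v ∈ˡ xs) → n ≤ length xs
covering⇒≤length xs cov =
  injective⇒≤ (λ {u} {v} → Membershipₛ.index-injective (setoid _) (cov u) (cov v))

length-concatMap-≤ : ∀ {b} {B : Set b} (f : A → List B) {k} →
  (∀ x → length (f x) ≤ k) → ∀ xs → length (concatMap f xs) ≤ length xs * k
length-concatMap-≤ f f≤k []       = z≤n
length-concatMap-≤ f f≤k (x ∷ xs) =
  ≤-trans (≤-reflexive (length-++ (f x))) (+-mono-≤ (f≤k x) (length-concatMap-≤ f f≤k xs))

elements : Subset n → List (Fin n)
elements []            = []
elements (inside  ∷ p) = zero ∷ map suc (elements p)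
elements (outside ∷ p) = map suc (elements p)

length-elements : (p : Subset n) → length (elements p) ≡ ∣ p ∣
length-elements []            = refl
length-elements (inside  ∷ p) = cong suc (trans (length-map suc (elements p)) (length-elements p))
length-elements (outside ∷ p) = trans (length-map suc (elements p)) (length-elements p)

∈-elements : ∀ {v} {p : Subset n} → v ∈ p → v ∈ˡ elements p
∈-elements                   here        = here refl
∈-elements {p = inside  ∷ _} (there v∈p) = there (∈-map⁺ suc (∈-elements v∈p))
∈-elements {p = outside ∷ _} (there v∈p) = ∈-map⁺ suc (∈-elements v∈p)

∣p∪q∣≤∣p∣+∣q∣ : (p q : Subset n) → ∣ p ∪ q ∣ ≤ ∣ p ∣ + ∣ q ∣
∣p∪q∣≤∣p∣+∣q∣ []            []            = z≤n
∣p∪q∣≤∣p∣+∣q∣ (outside ∷ p) (outside ∷ q) = ∣p∪q∣≤∣p∣+∣q∣ p q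
∣p∪q∣≤∣p∣+∣q∣ (outside ∷ p) (inside  ∷ q)
  rewrite +-suc ∣ p ∣ ∣ q ∣ = s≤s (∣p∪q∣≤∣p∣+∣q∣ p q)
∣p∪q∣≤∣p∣+∣q∣ (inside  ∷ p) (outside ∷ q) = s≤s (∣p∪q∣≤∣p∣+∣q∣ p q)
∣p∪q∣≤∣p∣+∣q∣ (inside  ∷ p) (inside  ∷ q)
  rewrite +-suc ∣ p ∣ ∣ q ∣ = s≤s (m≤n⇒m≤1+n (∣p∪q∣≤∣p∣+∣q∣ p q))

fromList : List (Fin n) → Subset n
fromList xs = ⋃ (map ⁅_⁆ xs)

∣fromList∣≤length : (xs : List (Fin n)) → ∣ fromList xs ∣ ≤ length xs
∣fromList∣≤length {n} []       = ≤-reflexive (∣⊥∣≡0 n)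
∣fromList∣≤length     (x ∷ xs) = ≤-trans (∣p∪q∣≤∣p∣+∣q∣ ⁅ x ⁆ (fromList xs))
  (+-mono-≤ (≤-reflexive (∣⁅x⁆∣≡1 x)) (∣fromList∣≤length xs))

∈-fromList : ∀ {v : Fin n} {xs} → v ∈ˡ xs → v ∈ fromList xs
∈-fromList {v = v} (here refl)  = x∈p∪q⁺ (inj₁ (x∈⁅x⁆ v))
∈-fromList         (there v∈xs) = x∈p∪q⁺ (inj₂ (∈-fromList v∈xs))

-- Lower bound on the domination number from the maximum degree.

-- The list `us` only has to contain the neighbourhood, so the same list still serves after an edge
-- is deleted.
MaxDegree≤ : ℕ → Graph n → Set
MaxDegree≤ Δ G = ∀ v → ∃[ us ] (length us ≤ Δ × (∀ {u} → Adj G v u → u ∈ˡ us))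

-- The closed neighbourhoods of the members of `D` cover all vertices, and each has at most `suc Δ`
-- elements.
order≤∣D∣*suc-Δ : ∀ {Δ} {G : Graph n} → MaxDegree≤ Δ G →
  (D : Subset n) → Dominating G D → n ≤ ∣ D ∣ * suc Δ
order≤∣D∣*suc-Δ {n} {Δ} {G} deg D dom = begin
  n                                    ≤⟨ covering⇒≤length _ covered ⟩
  length (concatMap N[_] (elements D)) ≤⟨ length-concatMap-≤ N[_] ∣N∣≤1+Δ (elements D) ⟩
  length (elements D) * suc Δ          ≡⟨ cong (_* suc Δ) (length-elements D) ⟩
  ∣ D ∣ * suc Δ                        ∎
  where
  open ≤-Reasoning

  N[_] : Fin n → List (Fin n)
  N[ v ] = v ∷ proj₁ (deg v)

  ∣N∣≤1+Δ : ∀ v → length N[ v ] ≤ suc Δ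
  ∣N∣≤1+Δ v = s≤s (proj₁ (proj₂ (deg v)))

  covered : ∀ v → v ∈ˡ concatMap N[_] (elements D)
  covered v with v ∈? D
  ... | yes v∈D = ∈-concatMap⁺ N[_] (lose (∈-elements v∈D) (here refl))
  ... | no  v∉D with dom v v∉D
  ...   | u , u∈D , u~v =
    ∈-concatMap⁺ N[_] (lose (∈-elements u∈D) (there (proj₂ (proj₂ (deg u)) u~v)))

[3+m]/3≡1+m/3 : ∀ m → (3 + m) / 3 ≡ suc (m / 3)
[3+m]/3≡1+m/3 m = +-distrib-/-∣ˡ {m = 3} m {d = 3} (divides-refl 1)

γ≥⌈order/3⌉ : {G : Graph n} → MaxDegree≤ 2 G → (2 + n) / 3 ≤ γ G
γ≥⌈order/3⌉ {G = G} deg =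
  let D , dom , ∣D∣≡γ = γ-attained G
      n≤γ*3 = subst (λ k → _ ≤ k * 3) ∣D∣≡γ (order≤∣D∣*suc-Δ {G = G} deg D dom)
  -- Adding 3 to both sides of `n ≤ γ G * 3` gives `2 + n < suc (γ G) * 3`, the strict bound that
  -- floor division needs.
  in ≤-pred (m<n*o⇒m/o<n {n = suc (γ G)} {o = 3} (+-monoʳ-≤ 3 n≤γ*3))

-- Upper bound on the domination number from a Hamiltonian path.

-- A list of length `n` that covers `Fin n` cannot repeat a vertex, so `covers` and `order` together
-- say that each vertex is visited exactly once. The start is an index so that paths can be extended
-- at that end.
record HamiltonianPath (G : Graph n) (v : Fin n) : Set where
  field
    rest   : List (Fin n)
    linked : Linked (Adj G) (v ∷ rest)
    covers : ∀ u → u ∈ˡ v ∷ rest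
    order  : length (v ∷ rest) ≡ n

open HamiltonianPath

-- The middle of each block of three, and the last element of a shorter final block.
everyThird : List A → List A
everyThird []               = []
everyThird (x ∷ [])         = [ x ]
everyThird (_ ∷ y ∷ [])     = [ y ]
everyThird (_ ∷ y ∷ _ ∷ xs) = y ∷ everyThird xs

length-everyThird : (xs : List A) → length (everyThird xs) ≡ (2 + length xs) / 3
length-everyThird []               = refl
length-everyThird (_ ∷ [])         = refl
length-everyThird (_ ∷ _ ∷ [])     = refl
length-everyThird (_ ∷ _ ∷ _ ∷ xs) =
  trans (cong suc (length-everyThird xs)) (sym ([3+m]/3≡1+m/3 (2 + length xs)))

-- Within its block, the chosen vertex is linked to each of the others, since they are its immediate
-- neighbours along the path.
everyThird-dominates : (G : Graph n) {xs : List (Fin n)} → Linked (Adj G) xs →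
  ∀ {v} → v ∈ˡ xs → v ∈ˡ everyThird xs ⊎ ∃[ u ] (u ∈ˡ everyThird xs × Adj G u v)
everyThird-dominates G [-] (here refl) = inj₁ (here refl)
everyThird-dominates G (r ∷ [-]) (here refl) = inj₂ (_ , here refl , Graph.sym G r)
everyThird-dominates G (r ∷ [-]) (there (here refl)) = inj₁ (here refl)
everyThird-dominates G (r ∷ s ∷ _) (here refl) = inj₂ (_ , here refl , Graph.sym G r)
everyThird-dominates G (r ∷ s ∷ _) (there (here refl)) = inj₁ (here refl)
everyThird-dominates G (r ∷ s ∷ _) (there (there (here refl))) = inj₂ (_ , here refl , s)
everyThird-dominates G (r ∷ s ∷ l) (there (there (there v∈xs)))
  with everyThird-dominates G (Linked.tail l) v∈xs
... | inj₁ v∈             = inj₁ (there v∈)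
... | inj₂ (u , u∈ , u~v) = inj₂ (u , there u∈ , u~v)

γ≤⌈order/3⌉ : {G : Graph n} {v : Fin n} → HamiltonianPath G v → γ G ≤ (2 + n) / 3
γ≤⌈order/3⌉ {n} {G} {v} P = begin
  γ G                           ≤⟨ γ-minimal G (fromList D) dom ⟩
  ∣ fromList D ∣                ≤⟨ ∣fromList∣≤length D ⟩
  length D                      ≡⟨ length-everyThird (v ∷ rest P) ⟩
  (2 + length (v ∷ rest P)) / 3 ≡⟨ cong (λ k → (2 + k) / 3) (order P) ⟩
  (2 + n) / 3                   ∎
  where
  open ≤-Reasoning

  D : List (Fin n)
  D = everyThird (v ∷ rest P)

  dom : Dominating G (fromList D)
  dom u u∉D with everyThird-dominates G (linked P) (covers P u)
  ... | inj₁ u∈D             = contradiction (∈-fromList u∈D) u∉D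
  ... | inj₂ (w , w∈D , w~u) = w , ∈-fromList w∈D , w~u

γ≡⌈order/3⌉ : {G : Graph n} {v : Fin n} →
  MaxDegree≤ 2 G → HamiltonianPath G v → γ G ≡ (2 + n) / 3
γ≡⌈order/3⌉ {G = G} deg P = ≤-antisym (γ≤⌈order/3⌉ P) (γ≥⌈order/3⌉ {G = G} deg)

Linked⇒Star : ∀ {R : Rel A ℓ} {x y xs} → Linked R (x ∷ xs) → y ∈ˡ x ∷ xs → Star R x y
Linked⇒Star _       (here refl)  = ε
Linked⇒Star (r ∷ l) (there y∈xs) = r ◅ Linked⇒Star l y∈xs

HamiltonianPath⇒Connected : {G : Graph n} {v : Fin n} → HamiltonianPath G v → Connected G
HamiltonianPath⇒Connected {G = G} P x y =
  reverse (Graph.sym G) (from (covers P x)) ◅◅ from (covers P y)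
  where
  from : ∀ {u} → u ∈ˡ _ → Star (Adj G) _ u
  from = Linked⇒Star (linked P)

-- Degrees and paths under edge deletion and subdivision.

MaxDegree≤-delete : ∀ {Δ} (G : Graph n) (e : Edge G) → MaxDegree≤ Δ G → MaxDegree≤ Δ (G -ₑ e)
MaxDegree≤-delete G e deg v =
  let us , ∣us∣≤Δ , ∈us = deg v in us , ∣us∣≤Δ , λ (v~u , _) → ∈us v~u

MaxDegree≤-subdivide : ∀ {Δ} (G : Graph n) (e : Edge G) → 2 ≤ Δ →
  MaxDegree≤ Δ G → MaxDegree≤ Δ (subdivide G e)
MaxDegree≤-subdivide G (edge a b a~b) 2≤Δ deg zero =
  suc a ∷ suc b ∷ [] , 2≤Δ , λ
    { {suc _} (inj₁ refl) → here refl
    ; {suc _} (inj₂ refl) → there (here refl) }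
-- At an end of e the new vertex takes the place of the other end.
MaxDegree≤-subdivide {n} {Δ} G e@(edge a b a~b) 2≤Δ deg (suc v) with deg v
... | us , ∣us∣≤Δ , ∈us =
  map reroute us , ≤-trans (≤-reflexive (length-map reroute us)) ∣us∣≤Δ , λ {u} → mem u
  where
  -- Any listed vertex not adjacent to `v` in `G -ₑ e` goes to `zero`. Mapping preserves the length,
  -- and surplus entries are harmless.
  reroute : Fin n → Fin (suc n)
  reroute u with adj? (G -ₑ e) v u
  ... | yes _ = suc u
  ... | no  _ = zero

  reroute-kept : ∀ {u} → Adj (G -ₑ e) v u → reroute u ≡ suc u
  reroute-kept {u} v~u with adj? (G -ₑ e) v u
  ... | yes _   = refl
  ... | no  v≁u = contradiction v~u v≁u

  reroute-a : v ≡ b → reroute a ≡ zero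
  reroute-a v≡b with adj? (G -ₑ e) v a
  ... | yes (_ , ¬e) = contradiction (inj₂ (v≡b , refl)) ¬e
  ... | no  _        = refl

  reroute-b : v ≡ a → reroute b ≡ zero
  reroute-b v≡a with adj? (G -ₑ e) v b
  ... | yes (_ , ¬e) = contradiction (inj₁ (v≡a , refl)) ¬e
  ... | no  _        = refl

  mem : ∀ u → Adj (subdivide G e) (suc v) u → u ∈ˡ map reroute us
  mem zero (inj₁ refl) = subst (_∈ˡ map reroute us) (reroute-b refl) (∈-map⁺ reroute (∈us a~b))
  mem zero (inj₂ refl) =
    subst (_∈ˡ map reroute us) (reroute-a refl) (∈-map⁺ reroute (∈us (Graph.sym G a~b)))
  mem (suc u) v~u =
    subst (_∈ˡ map reroute us) (reroute-kept v~u) (∈-map⁺ reroute (∈us (proj₁ v~u)))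

↭-allFin⇒HamiltonianPath : {G : Graph n} {v : Fin n} {ys : List (Fin n)} →
  Linked (Adj G) (v ∷ ys) → v ∷ ys ↭ allFin n → HamiltonianPath G v
↭-allFin⇒HamiltonianPath {n = n} l perm = record
  { linked = l
  ; covers = λ u → ∈-resp-↭ (↭-sym perm) (∈-allFin u)
  ; order  = trans (↭-length perm) (length-tabulate {n = n} (λ i → i))
  }

-- The new vertex is adjacent to both ends of `e`, so it can be put in front of a path of `G -ₑ e`
-- that starts at one of them.
subdivide-path : (G : Graph n) (e : Edge G) {v : Fin n} → v ≡ end₁ e ⊎ v ≡ end₂ e →
  HamiltonianPath (G -ₑ e) v → HamiltonianPath (subdivide G e) zero
subdivide-path G e {v} v∈e P = record
  { rest   = map suc (v ∷ rest P)
  ; linked = v∈e ∷ Linked.map⁺ (linked P)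
  ; covers = λ { zero → here refl ; (suc u) → there (∈-map⁺ suc (covers P u)) }
  ; order  = cong suc (trans (length-map suc (v ∷ rest P)) (order P))
  }

-- Cutting and rotating closed walks.

Linked-++-head : ∀ {R : Rel A ℓ} xs {ys} → Linked R (xs ++ ys) → Linked R xs
Linked-++-head []           _       = []
Linked-++-head (_ ∷ [])     _       = [-]
Linked-++-head (_ ∷ x ∷ xs) (r ∷ l) = r ∷ Linked-++-head (x ∷ xs) l

Linked-++-tail : ∀ {R : Rel A ℓ} xs {ys} → Linked R (xs ++ ys) → Linked R ys
Linked-++-tail []       l = l
Linked-++-tail (_ ∷ xs) l = Linked-++-tail xs (Linked.tail l)

-- The two walks share the vertex `y`, so no further link is required at the joint.
Linked-glue : ∀ {R : Rel A ℓ} xs {y ys zs} →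
  Linked R (xs ++ y ∷ ys) → Linked R (y ∷ zs) → Linked R (xs ++ y ∷ zs)
Linked-glue []           _       m = m
Linked-glue (_ ∷ [])     (r ∷ _) m = r ∷ m
Linked-glue (_ ∷ x ∷ xs) (r ∷ l) m = r ∷ Linked-glue (x ∷ xs) l m

-- Cut the closed walk at `v`: the part from `v` to the final `x` is followed by the part from the
-- initial `x` up to just before `v`.
rotate : ∀ {R : Rel A ℓ} {x xs v} → Linked R (x ∷ xs ++ [ x ]) → v ∈ˡ x ∷ xs →
  ∃[ ys ] (Linked R (v ∷ ys) × v ∷ ys ↭ x ∷ xs)
rotate {R = R} {x} {xs} {v} closed v∈ with ∈-∃++ v∈
... | [] , ys , refl = ys , Linked-++-head (x ∷ ys) closed , ↭-refl
... | .x ∷ us , ys , refl =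
  ys ++ x ∷ us ,
  Linked-glue (v ∷ ys) (Linked-++-tail (x ∷ us) closed′) (Linked-++-head (x ∷ us) closed′) ,
  ++-comm (v ∷ ys) (x ∷ us)
  where
  closed′ : Linked R ((x ∷ us) ++ v ∷ ys ++ [ x ])
  closed′ = subst (Linked R) (++-assoc (x ∷ us) (v ∷ ys) [ x ]) closed

Unique-resp-↭ : {xs ys : List A} → xs ↭ ys → Unique xs → Unique ys
Unique-resp-↭ perm = ↭ₛ.Unique-resp-↭ (setoid _) (↭⇒↭ₛ perm)

-- Every link ends in the tail, which does not contain `v`. This keeps a path around the cycle off
-- the deleted edge.
Linked-avoids-head : ∀ {R : Rel A ℓ} {v xs} → Unique (v ∷ xs) → Linked R (v ∷ xs) →
  Linked (λ x y → R x y × y ≢ v) (v ∷ xs)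
Linked-avoids-head {R = R} {v} (v≢xs ∷ _) = go v≢xs
  where
  go : ∀ {x xs} → All (v ≢_) xs → Linked R (x ∷ xs) → Linked (λ x y → R x y × y ≢ v) (x ∷ xs)
  go _            [-]     = [-]
  go (v≢y ∷ v≢xs) (r ∷ l) = (r , v≢y ∘ sym) ∷ go v≢xs l

Linked-tabulate-∷ʳ : ∀ {R : Rel A ℓ} {m z} (f : Fin (suc m) → A) →
  (∀ i → R (f (inject₁ i)) (f (suc i))) → R (f (fromℕ m)) z → Linked R (tabulate f ++ [ z ])
Linked-tabulate-∷ʳ {m = zero}  f step close = close ∷ [-]
Linked-tabulate-∷ʳ {m = suc m} f step close =
  step zero ∷ Linked-tabulate-∷ʳ (f ∘ suc) (step ∘ suc) close

-- Arcs, paths and domination numbers of the cycle.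

-- The orientation of Cₙ whose symmetric closure is, definitionally, Adj (cycle n 3≤n).
Next : Rel (Fin n) 0ℓ
Next {n} x y = toℕ y ≡ suc (toℕ x) ⊎ (suc (toℕ x) ≡ n × toℕ y ≡ 0)

-- Two successor steps cannot cancel, and opposite arcs of which one wraps around would force `n` to
-- be at most 2.
Next-asym : 3 ≤ n → {x y : Fin n} → Next x y → ¬ Next y x
Next-asym 3≤n = asym 3≤n
  where
  asym : ∀ {i j n} → 3 ≤ n →
    j ≡ suc i ⊎ (suc i ≡ n × j ≡ 0) → ¬ (i ≡ suc j ⊎ (suc j ≡ n × i ≡ 0))
  asym _              (inj₁ refl)          (inj₁ ())
  asym (s≤s (s≤s ())) (inj₁ refl)          (inj₂ (refl , refl))
  asym (s≤s (s≤s ())) (inj₂ (refl , refl)) (inj₁ refl)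

module _ {m : ℕ} where

  prev next : Fin (suc m) → Fin (suc m)
  prev zero    = fromℕ m
  prev (suc i) = inject₁ i
  next i with view i
  ... | ‵fromℕ     = zero
  ... | ‵inject₁ j = suc j

  Next⇒prev : ∀ {x y : Fin (suc m)} → Next x y → x ≡ prev y
  Next⇒prev {y = zero}  (inj₂ (1+x≡1+m , _)) =
    toℕ-injective (trans (suc-injective 1+x≡1+m) (sym (toℕ-fromℕ m)))
  Next⇒prev {y = suc i} (inj₁ 1+i≡1+x)       =
    toℕ-injective (trans (sym (suc-injective 1+i≡1+x)) (sym (toℕ-inject₁ i)))

  Next⇒next : ∀ {x y : Fin (suc m)} → Next x y → y ≡ next x
  Next⇒next {x} {y} x→y with view x
  Next⇒next {y = y} (inj₁ y≡1+x)       | ‵fromℕ     =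
    contradiction (trans y≡1+x (cong suc (toℕ-fromℕ m))) (<⇒≢ (toℕ<n y))
  Next⇒next         (inj₂ (_ , y≡0))   | ‵fromℕ     = toℕ-injective y≡0
  Next⇒next         (inj₁ y≡1+x)       | ‵inject₁ j =
    toℕ-injective (trans y≡1+x (cong suc (toℕ-inject₁ j)))
  Next⇒next         (inj₂ (1+x≡1+m , _)) | ‵inject₁ j =
    contradiction (trans (sym (toℕ-inject₁ j)) (suc-injective 1+x≡1+m)) (<⇒≢ (toℕ<n j))

  Next-path : (v : Fin (suc m)) → ∃[ ys ] (Linked Next (v ∷ ys) × v ∷ ys ↭ allFin (suc m))
  Next-path v = rotate closed (∈-allFin v)
    where
    -- The vertices in numerical order, then `zero` again: the last link is the arc that wraps
    -- around.
    closed : Linked Next (allFin (suc m) ++ [ zero ])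
    closed = Linked-tabulate-∷ʳ (λ i → i)
      (λ i → inj₁ (cong suc (sym (toℕ-inject₁ i))))
      (inj₂ (cong suc (toℕ-fromℕ m) , refl))

  module _ (3≤n : 3 ≤ suc m) where

    private
      C : Graph (suc m)
      C = cycle (suc m) 3≤n

    cycle-MaxDegree≤2 : MaxDegree≤ 2 C
    cycle-MaxDegree≤2 v = next v ∷ prev v ∷ [] , ≤-refl , λ
      { (inj₁ v→u) → here (Next⇒next v→u)
      ; (inj₂ u→v) → there (here (Next⇒prev u→v)) }

    cycle-path : ∀ v → HamiltonianPath C v
    cycle-path v =
      let _ , l , perm = Next-path v in ↭-allFin⇒HamiltonianPath (Linked.map inj₁ l) perm

    -- The path runs around the cycle from the head of e, and e is the only arc that
    -- returns to that head.
    cycle-delete-path : (e : Edge C) →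
      ∃[ v ] ((v ≡ end₁ e ⊎ v ≡ end₂ e) × HamiltonianPath (C -ₑ e) v)
    cycle-delete-path (edge a b (inj₁ a→b)) with Next-path b
    ... | ys , l , perm = b , inj₂ refl , ↭-allFin⇒HamiltonianPath (Linked.map kept l′) perm
      where
      l′ = Linked-avoids-head (Unique-resp-↭ (↭-sym perm) (allFin⁺ (suc m))) l
      -- A step along `e` would either enter `b`, excluded by `y ≢ b`, or run from `b` to `a`,
      -- opposite to the arc `a→b`.
      kept : ∀ {x y} → Next x y × y ≢ b → Adj (C -ₑ edge a b (inj₁ a→b)) x y
      kept (x→y , y≢b) = inj₁ x→y , λ
        { (inj₁ (_ , y≡b))     → y≢b y≡b
        ; (inj₂ (refl , refl)) → Next-asym 3≤n a→b x→y }
    -- Here `e` is stored against the orientation, so its head is `a`.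
    cycle-delete-path (edge a b (inj₂ b→a)) with Next-path a
    ... | ys , l , perm = a , inj₁ refl , ↭-allFin⇒HamiltonianPath (Linked.map kept l′) perm
      where
      l′ = Linked-avoids-head (Unique-resp-↭ (↭-sym perm) (allFin⁺ (suc m))) l
      kept : ∀ {x y} → Next x y × y ≢ a → Adj (C -ₑ edge a b (inj₂ b→a)) x y
      kept (x→y , y≢a) = inj₁ x→y , λ
        { (inj₁ (refl , refl)) → Next-asym 3≤n b→a x→y
        ; (inj₂ (_ , y≡a))     → y≢a y≡a }

    -- The order is `suc m`, so `3 + m` is `2 + suc m`; subdivision raises the order, and hence this
    -- numerator, by one.
    γ-cycle-delete : (e : Edge C) → γ (C -ₑ e) ≡ (3 + m) / 3
    γ-cycle-delete e = let _ , _ , P = cycle-delete-path e in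
      γ≡⌈order/3⌉ (MaxDegree≤-delete C e cycle-MaxDegree≤2) P

    γ-cycle-subdivide : (e : Edge C) → γ (subdivide C e) ≡ (4 + m) / 3
    γ-cycle-subdivide e = let _ , v∈e , P = cycle-delete-path e in
      γ≡⌈order/3⌉ (MaxDegree≤-subdivide C e ≤-refl cycle-MaxDegree≤2) (subdivide-path C e v∈e P)

-- Comparing the two ceilings modulo 3.

-- The multiple of 3 in `n` splits off, leaving a quotient that evaluates once `k` and `r` are
-- numerals.
[k+n]/3 : ∀ k n {r} → n % 3 ≡ r → (k + n) / 3 ≡ (k + r) / 3 + n / 3
[k+n]/3 k n {r} refl = begin
  (k + n) / 3                       ≡⟨ cong (λ j → (k + j) / 3) (m≡m%n+[m/n]*n n 3) ⟩
  (k + (r + n / 3 * 3)) / 3         ≡⟨ cong (_/ 3) (+-assoc k r _) ⟨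
  (k + r + n / 3 * 3) / 3           ≡⟨ +-distrib-/-∣ʳ (k + r) (divides-refl (n / 3)) ⟩
  (k + r) / 3 + n / 3 * 3 / 3       ≡⟨ cong ((k + r) / 3 +_) (m*n/n≡m (n / 3) 3) ⟩
  (k + r) / 3 + n / 3               ∎
  where open ≡-Reasoning

-- For remainder 1 or 2, both `(2 + r) / 3` and `(3 + r) / 3` evaluate to 1.
3∤n⇒⌈n/3⌉≡⌈[n+1]/3⌉ : ∀ n → n % 3 ≡ 1 ⊎ n % 3 ≡ 2 → (2 + n) / 3 ≡ (3 + n) / 3
3∤n⇒⌈n/3⌉≡⌈[n+1]/3⌉ n (inj₁ r) = trans ([k+n]/3 2 n r) (sym ([k+n]/3 3 n r))
3∤n⇒⌈n/3⌉≡⌈[n+1]/3⌉ n (inj₂ r) = trans ([k+n]/3 2 n r) (sym ([k+n]/3 3 n r))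

3∣n⇒⌈n/3⌉≢⌈[n+1]/3⌉ : ∀ n → n % 3 ≡ 0 → (2 + n) / 3 ≢ (3 + n) / 3
3∣n⇒⌈n/3⌉≢⌈[n+1]/3⌉ n r eq =
  -- For remainder 0 the leading quotients are `3 / 3`, which is 1, and `2 / 3`, which is 0, so
  -- equality would give `suc (n / 3) ≡ n / 3`.
  1+n≢n (trans (sym ([k+n]/3 3 n r)) (trans (sym eq) ([k+n]/3 2 n r)))

proposition3 : (n : ℕ) (3≤n : 3 ≤ n) →
    (n % 3 ≡ 1 ⊎ n % 3 ≡ 2 → IsSR (cycle n 3≤n)) ×
    (n % 3 ≡ 0 → IsASR (cycle n 3≤n))
proposition3 n@(suc _) 3≤n =
  (λ r → record
    { order≥2   = ≤-trans (n≤1+n 2) 3≤n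
    ; connected = HamiltonianPath⇒Connected (cycle-path 3≤n zero)
    ; γ-equal   = λ e → trans (γ-cycle-delete 3≤n e)
        (trans (3∤n⇒⌈n/3⌉≡⌈[n+1]/3⌉ n r) (sym (γ-cycle-subdivide 3≤n e)))
    }) ,
  (λ r → record
    { order≥2    = ≤-trans (n≤1+n 2) 3≤n
    ; connected  = HamiltonianPath⇒Connected (cycle-path 3≤n zero)
    ; γ-distinct = λ e γ≡ → 3∣n⇒⌈n/3⌉≢⌈[n+1]/3⌉ n r
        (trans (sym (γ-cycle-delete 3≤n e)) (trans γ≡ (γ-cycle-subdivide 3≤n e)))
    })
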